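{- For every $\mathcal F\in\beta\mathbb N$ the following conditions are equivalent: (i) the $=_\sim$-equivalence class $[\mathcal F]$ is a singleton; (ii) there are no distinct generators $x$ and $y$ of $\mathcal F$ such that $x\,{}^*\!\!\mid y$; (iii) there is a set $A\in\mathcal F$ which is an antichain for divisibility (no two distinct elements of $A$ divide one another).
   Context: $\mathbb N=\{1,2,3,\dots\}$; $\beta\mathbb N$ is the set of ultrafilters on $\mathbb N$, with $n\in\mathbb N$ identified with the principal ultrafilter at $n$. For $A\subseteq\mathbb N$ let $A\uparrow=\{n\in\mathbb N:(\exists a\in A)\,a\mid n\}$, and $\mathcal U=\{A\subseteq\mathbb N: A\ne\emptyset,\ A=A\uparrow\}$. For $\mathcal F,\mathcal G\in\beta\mathbb N$: $\mathcal F\,\widetilde{\mid}\,\mathcal G$ iff $\mathcal F\cap\mathcal U\subseteq\mathcal G$; $\mathcal F=_\sim\mathcal G$ iff $\mathcal F\,\widetilde{\mid}\,\mathcal G$ and $\mathcal G\,\widetilde{\mid}\,\mathcal F$; $[\mathcal F]$ is the $=_\sim$-equivalence class of $\mathcal F$. Standing assumption: we work in a fixed nonstandard extension ${}^*$ (of a superstructure over $\mathbb N$) which is $\mathfrak c^+$-saturated and satisfies Henson's isomorphism property (any two elementarily equivalent internally presented structures, for a finite first-order language, are isomorphic). For $x\in{}^*\mathbb N$, $tp(x/\mathbb N)=\{A\subseteq\mathbb N:x\in{}^*A\}\in\beta\mathbb N$; $x$ is a generator of $\mathcal F$ if $tp(x/\mathbb N)=\mathcal F$. ${}^*\!\mid$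 is the extension of the divisibility relation $\mid$ to ${}^*\mathbb N$. -}

module Defs where

open import Data.Bool.Base using (Bool; if_then_else_)
open import Data.Empty using (⊥)
open import Data.Fin.Base using (Fin)
open import Data.List.Base using (List)
open import Data.List.Relation.Unary.All using (All)
open import Data.Nat.Base using (ℕ; zero; suc; NonZero)
import Data.Nat.Divisibility as ℕ
open import Data.Product.Base using (Σ-syntax; ∃; ∃₂; _×_; _,_; proj₁; proj₂)
open import Data.Refinement.Base using (Refinement-syntax; value)
open import Data.Sum.Base using (_⊎_)
open import Data.Unit.Base using (⊤; tt)
open import Data.Vec.Functional using (Vector; []; _∷_; head; tail)
open import Function.Base using (_∘_)
open import Function.Bundles using (_⇔_; Injection)
open import Function.Definitions using (Congruent; Bijective)
open import Level using (0ℓ)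
open import Relation.Binary.Bundles using (Setoid)
open import Relation.Binary.Core using (Rel)
open import Relation.Binary.PropositionalEquality using (_≡_; _≢_; _→-setoid_)
open import Relation.Nullary using (¬_)
open import Relation.Unary using (Pred; _∈_; _∉_; _⊆_; _≐_; _∩_; ∁; Satisfiable; U; ∅)

------------------------------------------------------------------------
-- Divisibility and ultrafilters on {1, 2, 3, …}

ℕ⁺ : Set
ℕ⁺ = [ n ∈ ℕ ∣ NonZero n ]

_∣_ : Rel ℕ⁺ 0ℓ
m ∣ n = value m ℕ.∣ value n

Subset : Set₁
Subset = Pred ℕ⁺ 0ℓ

_↑ : Subset → Subset
(A ↑) n = ∃ λ a → a ∈ A × a ∣ n

𝒰 : Pred Subset 0ℓ
𝒰 A = Satisfiable A × A ≐ A ↑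

Antichain : Pred Subset 0ℓ
Antichain A = ∀ {a b} → a ∈ A → b ∈ A → a ≢ b → ¬ (a ∣ b)

record βℕ : Set₁ where
  field
    sets     : Pred Subset 0ℓ
    U∈       : U ∈ sets
    ∅∉       : ∅ ∉ sets
    ∩-closed : ∀ {A B} → A ∈ sets → B ∈ sets → (A ∩ B) ∈ sets
    ⊆-closed : ∀ {A B} → A ⊆ B → A ∈ sets → B ∈ sets
    ultra    : ∀ A → A ∈ sets ⊎ ∁ A ∈ sets

open βℕ public using (sets)

infix 4 _≋_ _∣~_ _=~_

-- Equality of ultrafilters, as collections of subsets.
_≋_ : Rel βℕ _
F ≋ G = sets F ≐ sets G

_∣~_ : Rel βℕ _
F ∣~ G = (sets F ∩ 𝒰) ⊆ sets G

_=~_ : Rel βℕ _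
F =~ G = F ∣~ G × G ∣~ F

[_] : βℕ → Pred βℕ _
[ F ] G = F =~ G

IsSingleton : ∀ {ℓ} → Pred βℕ ℓ → Set _
IsSingleton P = ∃ λ G → ∀ H → H ∈ P ⇔ H ≋ G

------------------------------------------------------------------------
-- Superstructures

-- Sets over the urelements X, presented as families of their members and
-- compared extensionally by _≈_ (Aczel's interpretation of sets).  In the
-- presence of excluded middle, every collection of elements of a fixed
-- finite rank is of this form, so bounding the rank yields the full
-- superstructure ⋃ₙ Vₙ(X), with V₀(X) = X and Vₙ₊₁(X) = Vₙ(X) ∪ 𝒫(Vₙ(X)).
data V (X : Set) : Set₁ where
  atom : X → V X
  set  : (I : Set) → (I → V X) → V X

module _ {X : Set} where

  infix 4 _≈_ _ε_
  infixl 9 _!_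

  Index : V X → Set
  Index (atom _)  = ⊥
  Index (set I _) = I

  _!_ : (a : V X) → Index a → V X
  set I f ! i = f i

  _≈_ : V X → V X → Set
  atom x  ≈ atom y  = x ≡ y
  atom _  ≈ set _ _ = ⊥
  set _ _ ≈ atom _  = ⊥
  set I f ≈ set J g = (∀ i → ∃ λ j → f i ≈ g j) × (∀ j → ∃ λ i → f i ≈ g j)

  _ε_ : V X → V X → Set
  x ε a = ∃ λ i → x ≈ a ! i

  -- a belongs to Vₙ(X)
  InRank : ℕ → V X → Set
  InRank n       (atom _)  = ⊤
  InRank zero    (set _ _) = ⊥
  InRank (suc n) (set _ f) = ∀ i → InRank n (f i)

  ∅ᵥ : V X
  ∅ᵥ = set ⊥ λ ()

  ⁅_,_⁆ : V X → V X → V X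
  ⁅ x , y ⁆ = set Bool λ b → if b then x else y

  -- Kuratowski pairs
  ⟨_,_⟩ : V X → V X → V X
  ⟨ x , y ⟩ = ⁅ ⁅ x , x ⁆ , ⁅ x , y ⁆ ⁆

  -- ⟨x₁,⟨x₂,…⟨xₖ,∅⟩…⟩⟩
  tuple : ∀ {k} → Vector (V X) k → V X
  tuple {zero}  _  = ∅ᵥ
  tuple {suc k} xs = ⟨ head xs , tuple (tail xs) ⟩

Superstructure : Set → Set₁
Superstructure X = Σ[ a ∈ V X ] ∃ λ n → InRank n a

⌜_⌝ : Subset → Superstructure ℕ⁺
⌜ A ⌝ = set (∃ A) (atom ∘ proj₁) , 1 , λ _ → tt

⌜∣⌝ : Superstructure ℕ⁺
⌜∣⌝ = set (∃₂ _∣_) (λ (m , n , _) → ⟨ atom m , atom n ⟩) , 3 , rank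
  where
  rank : ∀ p → InRank 2 ⟨ atom (proj₁ p) , atom (proj₁ (proj₂ p)) ⟩
  rank _ Bool.true  Bool.true  = tt
  rank _ Bool.true  Bool.false = tt
  rank _ Bool.false Bool.true  = tt
  rank _ Bool.false Bool.false = tt

-- Bounded formulas of set theory with n free variables (de Bruijn indices).
data BoundedFormula (n : ℕ) : Set where
  eq mem         : Fin n → Fin n → BoundedFormula n
  ⊥′             : BoundedFormula n
  _∧′_ _∨′_ _⇒′_ : BoundedFormula n → BoundedFormula n → BoundedFormula n
  all∈ ex∈       : Fin n → BoundedFormula (suc n) → BoundedFormula n

-- Every member of a is ≈ to some a ! i, so quantifying over the members of
-- a amounts to quantifying over Index a.
⟦_⟧ : ∀ {X n} → BoundedFormula n → Vector (V X) n → Set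
⟦ eq i j   ⟧ ρ = ρ i ≈ ρ j
⟦ mem i j  ⟧ ρ = ρ i ε ρ j
⟦ ⊥′       ⟧ ρ = ⊥
⟦ φ ∧′ ψ   ⟧ ρ = ⟦ φ ⟧ ρ × ⟦ ψ ⟧ ρ
⟦ φ ∨′ ψ   ⟧ ρ = ⟦ φ ⟧ ρ ⊎ ⟦ ψ ⟧ ρ
⟦ φ ⇒′ ψ   ⟧ ρ = ⟦ φ ⟧ ρ → ⟦ ψ ⟧ ρ
⟦ all∈ i φ ⟧ ρ = ∀ j → ⟦ φ ⟧ (ρ i ! j ∷ ρ)
⟦ ex∈ i φ  ⟧ ρ = ∃ λ j → ⟦ φ ⟧ (ρ i ! j ∷ ρ)

------------------------------------------------------------------------
-- First-order structures

record FiniteLanguage : Set where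
  field
    #rel #fun : ℕ
    relArity  : Fin #rel → ℕ
    funArity  : Fin #fun → ℕ

module _ (L : FiniteLanguage) where

  open FiniteLanguage L

  data Term (n : ℕ) : Set where
    var : Fin n → Term n
    app : ∀ f → (Fin (funArity f) → Term n) → Term n

  data Formula (n : ℕ) : Set where
    eq             : Term n → Term n → Formula n
    rel            : ∀ r → (Fin (relArity r) → Term n) → Formula n
    ⊥′             : Formula n
    _∧′_ _∨′_ _⇒′_ : Formula n → Formula n → Formula n
    all ex         : Formula (suc n) → Formula n

  -- The equality symbol is interpreted by _≈ᴹ_.
  record RawStructure : Set₁ where
    field
      Carrier : Set
      _≈ᴹ_    : Rel Carrier 0ℓ
      relᴹ    : ∀ r → Vector Carrier (relArity r) → Set
      funᴹ    : ∀ f → Vector Carrier (funArity f) → Carrier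

module _ {L : FiniteLanguage} where

  open FiniteLanguage L

  module _ (M : RawStructure L) where

    open RawStructure M

    eval : ∀ {n} → Vector Carrier n → Term L n → Carrier
    eval ρ (var i)    = ρ i
    eval ρ (app f ts) = funᴹ f (λ i → eval ρ (ts i))

    Satisfies : ∀ {n} → Vector Carrier n → Formula L n → Set
    Satisfies ρ (eq s t)   = eval ρ s ≈ᴹ eval ρ t
    Satisfies ρ (rel r ts) = relᴹ r (eval ρ ∘ ts)
    Satisfies ρ ⊥′         = ⊥
    Satisfies ρ (φ ∧′ ψ)   = Satisfies ρ φ × Satisfies ρ ψ
    Satisfies ρ (φ ∨′ ψ)   = Satisfies ρ φ ⊎ Satisfies ρ ψ
    Satisfies ρ (φ ⇒′ ψ)   = Satisfies ρ φ → Satisfies ρ ψ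
    Satisfies ρ (all φ)    = ∀ x → Satisfies (x ∷ ρ) φ
    Satisfies ρ (ex φ)     = ∃ λ x → Satisfies (x ∷ ρ) φ

  ElementarilyEquivalent : Rel (RawStructure L) 0ℓ
  ElementarilyEquivalent M N =
    ∀ (φ : Formula L 0) → Satisfies M [] φ ⇔ Satisfies N [] φ

  record Isomorphism (M N : RawStructure L) : Set where
    private
      module M = RawStructure M
      module N = RawStructure N
    field
      to        : M.Carrier → N.Carrier
      cong      : Congruent M._≈ᴹ_ N._≈ᴹ_ to
      bijective : Bijective M._≈ᴹ_ N._≈ᴹ_ to
      rel-⇔     : ∀ r xs → M.relᴹ r xs ⇔ N.relᴹ r (to ∘ xs)
      fun-homo  : ∀ f xs → to (M.funᴹ f xs) N.≈ᴹ N.funᴹ f (to ∘ xs)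

------------------------------------------------------------------------
-- Nonstandard extensions

record NonstandardExtension : Set₁ where
  field
    *ℕ       : Set
    *_       : Superstructure ℕ⁺ → Superstructure *ℕ
    *-ℕ      : proj₁ (* ⌜ U ⌝) ≈ set *ℕ atom
    transfer : ∀ {n} (φ : BoundedFormula n) (ρ : Vector (Superstructure ℕ⁺) n) →
               ⟦ φ ⟧ (proj₁ ∘ ρ) ⇔ ⟦ φ ⟧ (proj₁ ∘ *_ ∘ ρ)

module _ (E : NonstandardExtension) where

  open NonstandardExtension E

  Internal : V *ℕ → Set₁
  Internal x = ∃ λ a → x ε proj₁ (* a)

  -- Families of at most 2^ℵ₀ internal sets with the finite intersection
  -- property have nonempty intersection; I is the index set.
  𝔠⁺-Saturated : Set₁
  𝔠⁺-Saturated =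
    (I : Setoid 0ℓ 0ℓ) → let module I = Setoid I in
    Injection I (ℕ →-setoid Bool) →
    (S : I.Carrier → V *ℕ) → Congruent I._≈_ _≈_ S → (∀ i → Internal (S i)) →
    (∀ (is : List I.Carrier) → ∃ λ x → All (λ i → x ε S i) is) →
    ∃ λ x → ∀ i → x ε S i

  record InternalStructure (L : FiniteLanguage) : Set₁ where
    open FiniteLanguage L
    field
      dom            : V *ℕ
      dom-internal   : Internal dom
      dom-nonempty   : Index dom
      relation       : Fin #rel → V *ℕ
      rel-internal   : ∀ r → Internal (relation r)
      rel-⊆          : ∀ r t → t ε relation r →
                       ∃ λ (xs : Vector (Index dom) (relArity r)) →
                       t ≈ tuple ((dom !_) ∘ xs)
      function       : ∀ f → Vector (Index dom) (funArity f) → Index dom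
      graph          : Fin #fun → V *ℕ
      graph-internal : ∀ f → Internal (graph f)
      graph-⊆        : ∀ f t → t ε graph f →
                       ∃ λ (xs : Vector (Index dom) (suc (funArity f))) →
                       t ≈ tuple ((dom !_) ∘ xs)
      graph-fun      : ∀ f xs y →
                       tuple ((dom !_) ∘ (y ∷ xs)) ε graph f ⇔
                       dom ! y ≈ dom ! function f xs

    structure : RawStructure L
    structure = record
      { Carrier = Index dom
      ; _≈ᴹ_    = λ i j → dom ! i ≈ dom ! j
      ; relᴹ    = λ r xs → tuple ((dom !_) ∘ xs) ε relation r
      ; funᴹ    = function
      }

  open InternalStructure using (structure)

  IsomorphismProperty : Set₁
  IsomorphismProperty =
    ∀ {L} (M N : InternalStructure L) →
    ElementarilyEquivalent (structure M) (structure N) →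
    Isomorphism (structure M) (structure N)

  tp : *ℕ → Pred Subset 0ℓ
  tp x A = atom x ε proj₁ (* ⌜ A ⌝)

  Generator : βℕ → *ℕ → Set₁
  Generator F x = tp x ≐ sets F

  _*∣_ : Rel *ℕ 0ℓ
  x *∣ y = ⟨ atom x , atom y ⟩ ε proj₁ (* ⌜∣⌝)

{-# OPTIONS --safe #-}

-- It suffices to show (iii) ⇒ (i) ⇒ (ii) ⇒ (iii).
--
-- (iii) ⇒ (i): if A ∈ F is an antichain, then A is the difference of the
-- upward closed sets A ↑ and {n : n is a proper multiple of some a ∈ A}, so
-- every H =~ F contains A, and likewise C ∩ A for every C ∈ F.
--
-- (i) ⇒ (ii): let x ≢ y be generators of F with x *∣ y.  By transfer there is
-- z with x *∣ z *∣ y such that z has exactly one more prime factor than x,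
-- counted with multiplicity.  Then tp z =~ F, but the set of numbers with an
-- even number of prime factors distinguishes tp z from tp x.
--
-- (ii) ⇒ (iii): if no A ∈ F is an antichain, saturation applied to the
-- internal sets of pairs a *∣ b of distinct elements of *A, for A ∈ F, yields
-- two distinct generators of F one of which divides the other.

module Submission where

open import Defs
open import Axiom.ExcludedMiddle using (ExcludedMiddle)
open import Data.Bool.Base using (Bool; true; false)
open import Data.Empty using (⊥; ⊥-elim)
open import Data.Fin.Base using (Fin; zero; suc)
open import Data.Fin.Patterns using (0F; 1F; 2F)
import Data.Irrelevant as Irrelevant
open import Data.List.Base as List using (List; length)
open import Data.List.Relation.Binary.Permutation.Propositional.Properties using (↭-length)
open import Data.List.Relation.Unary.All as All using (All)
open import Data.Nat.Base using (ℕ; zero; suc; _*_; parity)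
open import Data.Nat.Divisibility using (divides; ∣-refl; ∣-trans; ∣-antisym; n∣m*n; *-monoˡ-∣; m∣m*n)
open import Data.Nat.Primality using (prime⇒nonZero)
open import Data.Nat.Primality.Factorisation using (PrimeFactorisation; factorise; factors; factorisationUnique)
open import Data.Nat.Properties using (m*n≢0; m*n≢0⇒m≢0; *-identityˡ)
open import Data.Parity.Base using (0ℙ; 1ℙ)
open import Data.Parity.Properties using (suc-homo-⁻¹)
open import Data.Product.Base using (∃; ∃₂; _×_; _,_; proj₁; proj₂; -,_)
open import Data.Product.Function.NonDependent.Propositional using (_×-⇔_)
open import Data.Refinement.Base using (value; _,_)
open import Data.Refinement.Properties using (value-injective)
open import Data.Sum.Base using (_⊎_; inj₁; inj₂; [_,_]′)
import Data.Sum.Base as Sum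
open import Data.Sum.Function.Propositional using (_⊎-⇔_)
open import Data.Unit.Base using (tt)
open import Data.Vec.Functional using (Vector; []; _∷_)
open import Function.Base using (_∘_; id)
open import Function.Bundles using (_⇔_; mk⇔; Equivalence)
open import Function.Construct.Composition using (_⇔-∘_)
open import Function.Construct.Identity using (⇔-id)
open import Function.Related.TypeIsomorphisms using (→-cong-⇔)
open import Level using (0ℓ)
open import Relation.Binary.Bundles using (Setoid)
import Relation.Binary.Construct.On as On
open import Relation.Binary.Core using (Rel)
open import Relation.Binary.PropositionalEquality using (_≡_; _≢_; refl; sym; trans; cong; subst; _→-setoid_)
open import Relation.Nullary using (¬_; yes; no; does)
open import Relation.Nullary.Decidable using (dec-true)
open import Relation.Unary using (_∈_; _∉_; _⊆_; _≐_; _∩_; ∁; Satisfiable; U; ∅)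

open Equivalence using (to; from)

-- Extensional equality and Kuratowski pairs

module _ {X : Set} where

  ≈-refl : (a : V X) → a ≈ a
  ≈-refl (atom _)  = refl
  ≈-refl (set _ f) = (λ i → i , ≈-refl (f i)) , (λ i → i , ≈-refl (f i))

  ≈-sym : (a b : V X) → a ≈ b → b ≈ a
  ≈-sym (atom _)  (atom _)  p = sym p
  ≈-sym (set _ f) (set _ g) (p , q) =
    (λ j → let i , r = q j in i , ≈-sym (f i) (g j) r) ,
    (λ i → let j , r = p i in j , ≈-sym (f i) (g j) r)

  ≈-trans : (a b c : V X) → a ≈ b → b ≈ c → a ≈ c
  ≈-trans (atom _)  (atom _)  (atom _)  p q = trans p q
  ≈-trans (set _ f) (set _ g) (set _ h) (p , p′) (q , q′) =
    (λ i → let j , r = p i; k , s = q j in k , ≈-trans (f i) (g j) (h k) r s) ,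
    (λ k → let j , s = q′ k; i , r = p′ j in i , ≈-trans (f i) (g j) (h k) r s)

  ≈-members : (a b : V X) → a ≈ b → ∀ i → ∃ λ j → a ! i ≈ b ! j
  ≈-members (set _ _) (set _ _) (p , _) = p

  ≈-cong : ∀ {a a′ b b′ : V X} → a ≈ a′ → b ≈ b′ → a ≈ b ⇔ a′ ≈ b′
  ≈-cong {a} {a′} {b} {b′} p q = mk⇔
    (λ r → ≈-trans a′ a b′ (≈-sym a a′ p) (≈-trans a b b′ r q))
    (λ r → ≈-trans a a′ b p (≈-trans a′ b′ b r (≈-sym b b′ q)))

  ε-resp : ∀ {x y a b : V X} → x ≈ y → a ≈ b → x ε a → y ε b
  ε-resp {x} {y} {a} {b} x≈y a≈b (i , x≈aᵢ) =
    let j , aᵢ≈bⱼ = ≈-members a b a≈b i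
    in j , to (≈-cong {a = x} {b = a ! i} x≈y aᵢ≈bⱼ) x≈aᵢ

  ε-cong : ∀ {x y a b : V X} → x ≈ y → a ≈ b → x ε a ⇔ y ε b
  ε-cong {x} {y} {a} {b} p q = mk⇔
    (ε-resp {x} {y} {a} {b} p q)
    (ε-resp {y} {x} {b} {a} (≈-sym x y p) (≈-sym a b q))

  !-ε : (a : V X) (i : Index a) → (a ! i) ε a
  !-ε a i = i , ≈-refl (a ! i)

  ⁅⁆-cong : ∀ {x x′ y y′ : V X} → x ≈ x′ → y ≈ y′ → ⁅ x , y ⁆ ≈ ⁅ x′ , y′ ⁆
  ⁅⁆-cong p q =
    (λ { true → true , p ; false → false , q }) ,
    (λ { true → true , p ; false → false , q })

  ⟨⟩-cong : ∀ {x x′ y y′ : V X} → x ≈ x′ → y ≈ y′ → ⟨ x , y ⟩ ≈ ⟨ x′ , y′ ⟩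
  ⟨⟩-cong {x} {x′} {y} {y′} p q =
    ⁅⁆-cong {⁅ x , x ⁆} {⁅ x′ , x′ ⁆} {⁅ x , y ⁆} {⁅ x′ , y′ ⁆}
      (⁅⁆-cong {x} {x′} {x} {x′} p p) (⁅⁆-cong {x} {x′} {y} {y′} p q)

  -- The left-hand side is what `isUnorderedPair` unfolds to, which lets a bounded formula say that
  -- a set is an unordered pair.
  ≈⁅⁆⇔ : (u x y : V X) →
         (x ε u × y ε u × (∀ i → u ! i ≈ x ⊎ u ! i ≈ y)) ⇔ u ≈ ⁅ x , y ⁆
  ≈⁅⁆⇔ u x y = mk⇔ (⇒ u) (⇐ u)
    where
    ⇒ : ∀ u → x ε u × y ε u × (∀ i → u ! i ≈ x ⊎ u ! i ≈ y) → u ≈ ⁅ x , y ⁆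
    ⇒ (set I f) ((i , p) , (j , q) , h) =
      (λ k → [ true ,_ , false ,_ ]′ (h k)) ,
      (λ { true → i , ≈-sym x (f i) p ; false → j , ≈-sym y (f j) q })

    ⇐ : ∀ u → u ≈ ⁅ x , y ⁆ → x ε u × y ε u × (∀ i → u ! i ≈ x ⊎ u ! i ≈ y)
    ⇐ (set I f) (p , q) =
      (let i , r = q true  in i , ≈-sym (f i) x r) ,
      (let i , r = q false in i , ≈-sym (f i) y r) ,
      λ i → split (p i)
      where
      split : ∀ {i} → ∃ (λ b → f i ≈ ⁅ x , y ⁆ ! b) → f i ≈ x ⊎ f i ≈ y
      split (true  , r) = inj₁ r
      split (false , r) = inj₂ r

  ⁅atom⁆-injective : ∀ {x y z w : X} → ⁅ atom x , atom y ⁆ ≈ ⁅ atom z , atom w ⁆ →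
                     (x ≡ z ⊎ x ≡ w) × (y ≡ z ⊎ y ≡ w) × (z ≡ x ⊎ z ≡ y) × (w ≡ x ⊎ w ≡ y)
  ⁅atom⁆-injective (p , q) = right (p true) , right (p false) , left (q true) , left (q false)
    where
    right : ∀ {x z w : X} → ∃ (λ b → atom x ≈ ⁅ atom z , atom w ⁆ ! b) → x ≡ z ⊎ x ≡ w
    right (true  , r) = inj₁ r
    right (false , r) = inj₂ r
    left : ∀ {z x y : X} → ∃ (λ b → ⁅ atom x , atom y ⁆ ! b ≈ atom z) → z ≡ x ⊎ z ≡ y
    left (true  , r) = inj₁ (sym r)
    left (false , r) = inj₂ (sym r)

  ⟨atom⟩-injective : ∀ {x y z w : X} → ⟨ atom x , atom y ⟩ ≈ ⟨ atom z , atom w ⟩ → x ≡ z × y ≡ w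
  ⟨atom⟩-injective {x} {y} {z} {w} (p , q) = x≡z , y≡w
    where
    ⁅x⁆≈ : ∃ (λ b → ⁅ atom x , atom x ⁆ ≈ ⟨ atom z , atom w ⟩ ! b) → x ≡ z
    ⁅x⁆≈ (true  , r) = [ id , id ]′ (proj₁ (⁅atom⁆-injective r))
    ⁅x⁆≈ (false , r) = [ sym , sym ]′ (proj₁ (proj₂ (proj₂ (⁅atom⁆-injective r))))

    x≡z : x ≡ z
    x≡z = ⁅x⁆≈ (p true)

    y∈ : ∃ (λ b → ⁅ atom x , atom y ⁆ ≈ ⟨ atom z , atom w ⟩ ! b) → y ≡ z ⊎ y ≡ w
    y∈ (true  , r) = inj₁ ([ id , id ]′ (proj₁ (proj₂ (⁅atom⁆-injective r))))
    y∈ (false , r) = proj₁ (proj₂ (⁅atom⁆-injective r))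

    w∈ : ∃ (λ b → ⟨ atom x , atom y ⟩ ! b ≈ ⁅ atom z , atom w ⁆) → w ≡ x ⊎ w ≡ y
    w∈ (true  , r) = inj₁ ([ id , id ]′ (proj₂ (proj₂ (proj₂ (⁅atom⁆-injective r)))))
    w∈ (false , r) = proj₂ (proj₂ (proj₂ (⁅atom⁆-injective r)))

    y≡w : y ≡ w
    y≡w with y∈ (p false) | w∈ (q false)
    ... | inj₂ y≡w | _        = y≡w
    ... | inj₁ _   | inj₂ w≡y = sym w≡y
    -- In this degenerate case all four components coincide: y = z = x = w.
    ... | inj₁ y≡z | inj₁ w≡x = trans y≡z (trans (sym x≡z) (sym w≡x))

-- The encoding of `⌜∣⌝` for an arbitrary relation. At `_∣_` the underlying sets agree by
-- computation, so facts about `⌜ R ⌝₂` apply to `⌜∣⌝`.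
⌜_⌝₂ : Rel ℕ⁺ 0ℓ → Superstructure ℕ⁺
⌜ R ⌝₂ = set (∃₂ R) (λ (m , n , _) → ⟨ atom m , atom n ⟩) , 3 ,
         λ _ → λ { true  → λ { true → tt ; false → tt }
                 ; false → λ { true → tt ; false → tt } }

∈⌜⌝⇔ : ∀ {A : Subset} {a} → atom a ε proj₁ ⌜ A ⌝ ⇔ a ∈ A
∈⌜⌝⇔ = mk⇔ (λ { ((_ , a∈A) , refl) → a∈A }) (λ a∈A → (-, a∈A) , refl)

∈⌜⌝₂⇔ : ∀ {R : Rel ℕ⁺ 0ℓ} {a b} → ⟨ atom a , atom b ⟩ ε proj₁ ⌜ R ⌝₂ ⇔ R a b
∈⌜⌝₂⇔ {R} {a} {b} = mk⇔ ⇒ λ r → (a , b , r) , ≈-refl ⟨ atom a , atom b ⟩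
  where
  ⇒ : ⟨ atom a , atom b ⟩ ε proj₁ ⌜ R ⌝₂ → R a b
  ⇒ ((c , d , r) , p) with refl , refl ← ⟨atom⟩-injective {x = a} {b} {c} {d} p = r

ProperDivisors : Subset → Rel ℕ⁺ 0ℓ
ProperDivisors A a b = a ∈ A × b ∈ A × a ≢ b × a ∣ b

⌜⌝₂-mono : ∀ {R S : Rel ℕ⁺ 0ℓ} → (∀ {a b} → R a b → S a b) →
           ∀ i → ∃ λ j → proj₁ ⌜ R ⌝₂ ! i ≈ proj₁ ⌜ S ⌝₂ ! j
⌜⌝₂-mono R⊆S (a , b , r) = (a , b , R⊆S r) , ≈-refl ⟨ atom a , atom b ⟩

-- Serves the congruence condition of saturation: pointwise equal codes decode to extensionally
-- equal subsets.
⌜ProperDivisors⌝-cong : ∀ {A B} → A ≐ B →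
  proj₁ ⌜ ProperDivisors A ⌝₂ ≈ proj₁ ⌜ ProperDivisors B ⌝₂
⌜ProperDivisors⌝-cong (A⊆B , B⊆A) =
  ⌜⌝₂-mono (λ (a∈A , b∈A , r) → A⊆B a∈A , A⊆B b∈A , r) ,
  λ j → let i , p = ⌜⌝₂-mono (λ (a∈B , b∈B , r) → B⊆A a∈B , B⊆A b∈B , r) j
        in i , ≈-sym (proj₁ ⌜ _ ⌝₂ ! j) (proj₁ ⌜ _ ⌝₂ ! i) p

-- Bounded formulas for pairs

isUnorderedPair : ∀ {n} → Fin n → Fin n → Fin n → BoundedFormula n
isUnorderedPair u x y =
  mem x u ∧′ (mem y u ∧′ all∈ u (eq zero (suc x) ∨′ eq zero (suc y)))

-- Both components {x} and {x, y} of a Kuratowski pair are members of it, so quantifiers bounded by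
-- p itself suffice.
isPair : ∀ {n} → Fin n → Fin n → Fin n → BoundedFormula n
isPair p x y =
  ex∈ p (isUnorderedPair zero (suc x) (suc x) ∧′
         ex∈ (suc p) (isUnorderedPair zero (suc (suc x)) (suc (suc y)) ∧′
                      isUnorderedPair (suc (suc p)) (suc zero) zero))

pairMem : ∀ {n} → Fin n → Fin n → Fin n → BoundedFormula n
pairMem x y a = ex∈ a (isPair zero (suc x) (suc y))

isUnorderedPair-⇔ : ∀ {X : Set} {n} (ρ : Vector (V X) n) u x y →
                    ⟦ isUnorderedPair u x y ⟧ ρ ⇔ ρ u ≈ ⁅ ρ x , ρ y ⁆
isUnorderedPair-⇔ ρ u x y = ≈⁅⁆⇔ (ρ u) (ρ x) (ρ y)

isPair-⇔ : ∀ {X : Set} {n} (ρ : Vector (V X) n) p x y →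
           ⟦ isPair p x y ⟧ ρ ⇔ ρ p ≈ ⟨ ρ x , ρ y ⟩
isPair-⇔ {X} {n} ρ p x y = mk⇔ ⇒ ⇐
  where
  a : V X
  a = ρ p

  ρ₁ : Index a → Vector (V X) (suc n)
  ρ₁ i = a ! i ∷ ρ

  ρ₂ : Index a → Index a → Vector (V X) (suc (suc n))
  ρ₂ i j = a ! j ∷ ρ₁ i

  ⇒ : ⟦ isPair p x y ⟧ ρ → a ≈ ⟨ ρ x , ρ y ⟩
  ⇒ (i , u , j , v , w) =
    ≈-trans a ⁅ a ! i , a ! j ⁆ ⟨ ρ x , ρ y ⟩
      (to (isUnorderedPair-⇔ (ρ₂ i j) (suc (suc p)) 1F 0F) w)
      (⁅⁆-cong {x = a ! i} {⁅ ρ x , ρ x ⁆} {a ! j} {⁅ ρ x , ρ y ⁆}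
        (to (isUnorderedPair-⇔ (ρ₁ i) 0F (suc x) (suc x)) u)
        (to (isUnorderedPair-⇔ (ρ₂ i j) 0F (suc (suc x)) (suc (suc y))) v))

  ⇐ : a ≈ ⟨ ρ x , ρ y ⟩ → ⟦ isPair p x y ⟧ ρ
  ⇐ a≈ = i ,
    from (isUnorderedPair-⇔ (ρ₁ i) 0F (suc x) (suc x)) aᵢ≈ , j ,
    from (isUnorderedPair-⇔ (ρ₂ i j) 0F (suc (suc x)) (suc (suc y))) aⱼ≈ ,
    from (isUnorderedPair-⇔ (ρ₂ i j) (suc (suc p)) 1F 0F)
      (≈-trans a ⟨ ρ x , ρ y ⟩ ⁅ a ! i , a ! j ⁆ a≈
        (⁅⁆-cong {x = ⁅ ρ x , ρ x ⁆} {a ! i} {⁅ ρ x , ρ y ⁆} {a ! j}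
          (≈-sym (a ! i) ⁅ ρ x , ρ x ⁆ aᵢ≈) (≈-sym (a ! j) ⁅ ρ x , ρ y ⁆ aⱼ≈)))
    where
    member : ∀ b → ∃ λ i → ⟨ ρ x , ρ y ⟩ ! b ≈ a ! i
    member = ≈-members ⟨ ρ x , ρ y ⟩ a (≈-sym a ⟨ ρ x , ρ y ⟩ a≈)
    i j : Index a
    i = proj₁ (member true)
    j = proj₁ (member false)
    aᵢ≈ : a ! i ≈ ⁅ ρ x , ρ x ⁆
    aᵢ≈ = ≈-sym ⁅ ρ x , ρ x ⁆ (a ! i) (proj₂ (member true))
    aⱼ≈ : a ! j ≈ ⁅ ρ x , ρ y ⁆
    aⱼ≈ = ≈-sym ⁅ ρ x , ρ y ⁆ (a ! j) (proj₂ (member false))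

pairMem-⇔ : ∀ {X : Set} {n} (ρ : Vector (V X) n) x y a →
            ⟦ pairMem x y a ⟧ ρ ⇔ ⟨ ρ x , ρ y ⟩ ε ρ a
pairMem-⇔ ρ x y a = mk⇔
  (λ (i , φ) → i , ≈-sym (ρ a ! i) ⟨ ρ x , ρ y ⟩ (to (⇔ᵢ i) φ))
  (λ (i , p) → i , from (⇔ᵢ i) (≈-sym ⟨ ρ x , ρ y ⟩ (ρ a ! i) p))
  where
  ⇔ᵢ : ∀ i → ⟦ isPair zero (suc x) (suc y) ⟧ (ρ a ! i ∷ ρ) ⇔ ρ a ! i ≈ ⟨ ρ x , ρ y ⟩
  ⇔ᵢ i = isPair-⇔ (ρ a ! i ∷ ρ) zero (suc x) (suc y)

-- First-order formulas over the urelements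

-- n variables ranging over urelements and k parameters, each a set of
-- urelements (∈₁) or of pairs of urelements (∈₂).
data FOFormula (k n : ℕ) : Set where
  eq   : Fin n → Fin n → FOFormula k n
  ∈₁   : Fin n → Fin k → FOFormula k n
  ∈₂   : Fin n → Fin n → Fin k → FOFormula k n
  ⊥′   : FOFormula k n
  _∧′_ _∨′_ _⇒′_ : FOFormula k n → FOFormula k n → FOFormula k n
  all ex : FOFormula k (suc n) → FOFormula k n

infixr 6 _∧′_
infixr 5 _∨′_
infixr 4 _⇒′_

Holds : ∀ {X : Set} {k n} → FOFormula k n → Vector (V X) k → Vector X n → Set
Holds         (eq i j)   P e = e i ≡ e j
Holds         (∈₁ i k)   P e = atom (e i) ε P k
Holds         (∈₂ i j k) P e = ⟨ atom (e i) , atom (e j) ⟩ ε P k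
Holds         ⊥′         P e = ⊥
Holds         (φ ∧′ ψ)   P e = Holds φ P e × Holds ψ P e
Holds         (φ ∨′ ψ)   P e = Holds φ P e ⊎ Holds ψ P e
Holds         (φ ⇒′ ψ)   P e = Holds φ P e → Holds ψ P e
Holds {X = X} (all φ)    P e = ∀ (x : X) → Holds φ P (x ∷ e)
Holds {X = X} (ex φ)     P e = ∃ λ (x : X) → Holds φ P (x ∷ e)

-- N is the index of the set of all urelements, which bounds the quantifiers.
bounded : ∀ {k n m} → FOFormula k n →
          Fin m → Vector (Fin m) k → Vector (Fin m) n → BoundedFormula m
bounded (eq i j)   N τ σ = eq (σ i) (σ j)
bounded (∈₁ i k)   N τ σ = mem (σ i) (τ k)
bounded (∈₂ i j k) N τ σ = pairMem (σ i) (σ j) (τ k)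
bounded ⊥′         N τ σ = ⊥′
bounded (φ ∧′ ψ)   N τ σ = bounded φ N τ σ ∧′ bounded ψ N τ σ
bounded (φ ∨′ ψ)   N τ σ = bounded φ N τ σ ∨′ bounded ψ N τ σ
bounded (φ ⇒′ ψ)   N τ σ = bounded φ N τ σ ⇒′ bounded ψ N τ σ
bounded (all φ)    N τ σ = all∈ N (bounded φ (suc N) (suc ∘ τ) (zero ∷ suc ∘ σ))
bounded (ex φ)     N τ σ = ex∈ N (bounded φ (suc N) (suc ∘ τ) (zero ∷ suc ∘ σ))

-- The environments agree only up to `≈`, because that is all `*-ℕ` provides. Quantifying over the
-- members of ρ N amounts to quantifying over X, since each member is `≈` to an atom and each atom
-- to a member.
bounded-⇔ : ∀ {X : Set} {k n m} (φ : FOFormula k n) {N : Fin m} {τ σ}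
            {ρ : Vector (V X) m} {P : Vector (V X) k} {e : Vector X n} →
            ρ N ≈ set X atom → (∀ j → ρ (τ j) ≈ P j) → (∀ i → ρ (σ i) ≈ atom (e i)) →
            ⟦ bounded φ N τ σ ⟧ ρ ⇔ Holds φ P e
bounded-⇔ (eq i j) {σ = σ} {ρ} {e = e} N≈ P≈ e≈ =
  ≈-cong {a = ρ (σ i)} {atom (e i)} {ρ (σ j)} {atom (e j)} (e≈ i) (e≈ j)
bounded-⇔ (∈₁ i k) {τ = τ} {σ} {ρ} {P} {e} N≈ P≈ e≈ =
  ε-cong {x = ρ (σ i)} {atom (e i)} {ρ (τ k)} {P k} (e≈ i) (P≈ k)
bounded-⇔ (∈₂ i j k) {τ = τ} {σ} {ρ} {P} {e} N≈ P≈ e≈ =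
  ε-cong {x = ⟨ ρ (σ i) , ρ (σ j) ⟩} {⟨ atom (e i) , atom (e j) ⟩} {ρ (τ k)} {P k}
    (⟨⟩-cong {x = ρ (σ i)} {atom (e i)} {ρ (σ j)} {atom (e j)} (e≈ i) (e≈ j)) (P≈ k)
  ⇔-∘ pairMem-⇔ ρ (σ i) (σ j) (τ k)
bounded-⇔ ⊥′       N≈ P≈ e≈ = ⇔-id _
bounded-⇔ (φ ∧′ ψ) N≈ P≈ e≈ = bounded-⇔ φ N≈ P≈ e≈ ×-⇔ bounded-⇔ ψ N≈ P≈ e≈
bounded-⇔ (φ ∨′ ψ) N≈ P≈ e≈ = bounded-⇔ φ N≈ P≈ e≈ ⊎-⇔ bounded-⇔ ψ N≈ P≈ e≈
bounded-⇔ (φ ⇒′ ψ) N≈ P≈ e≈ = →-cong-⇔ (bounded-⇔ φ N≈ P≈ e≈) (bounded-⇔ ψ N≈ P≈ e≈)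
bounded-⇔ {X} (all φ) {N} {ρ = ρ} {P} {e} N≈ P≈ e≈ = mk⇔
  (λ h x → let j , p = ≈-members (set X atom) (ρ N) (≈-sym (ρ N) (set X atom) N≈) x
           in to (step j x (≈-sym (atom x) (ρ N ! j) p)) (h j))
  (λ h j → let x , p = ≈-members (ρ N) (set X atom) N≈ j in from (step j x p) (h x))
  where
  step : ∀ j x → ρ N ! j ≈ atom x → _ ⇔ Holds φ P (x ∷ e)
  step j x p = bounded-⇔ φ {ρ = ρ N ! j ∷ ρ} N≈ P≈ λ { zero → p ; (suc i) → e≈ i }
bounded-⇔ {X} (ex φ) {N} {ρ = ρ} {P} {e} N≈ P≈ e≈ = mk⇔
  (λ (j , h) → let x , p = ≈-members (ρ N) (set X atom) N≈ j in x , to (step j x p) h)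
  (λ (x , h) → let j , p = ≈-members (set X atom) (ρ N) (≈-sym (ρ N) (set X atom) N≈) x
               in j , from (step j x (≈-sym (atom x) (ρ N ! j) p)) h)
  where
  step : ∀ j x → ρ N ! j ≈ atom x → _ ⇔ Holds φ P (x ∷ e)
  step j x p = bounded-⇔ φ {ρ = ρ N ! j ∷ ρ} N≈ P≈ λ { zero → p ; (suc i) → e≈ i }

-- Ultrafilters

disjoint∉ : ∀ (F : βℕ) {A B} → A ∈ sets F → A ∩ B ⊆ ∅ → B ∉ sets F
disjoint∉ F A∈F A∩B⊆∅ B∈F = ∅∉ (⊆-closed A∩B⊆∅ (∩-closed A∈F B∈F))
  where open βℕ F

-- Ultrafilters are maximal: a set in `G` but not in `F` would have its complement in `F`, hence in
-- `G`.
⊆⇒≋ : ∀ (F G : βℕ) → sets F ⊆ sets G → F ≋ G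
⊆⇒≋ F G F⊆G = F⊆G , G⊆F
  where
  G⊆F : sets G ⊆ sets F
  G⊆F {A} A∈G with βℕ.ultra F A
  ... | inj₁ A∈F  = A∈F
  ... | inj₂ ∁A∈F = ⊥-elim (disjoint∉ G A∈G (λ (a , ¬a) → ¬a a) (F⊆G ∁A∈F))

-- Numbers of prime factors

Ω : ℕ⁺ → ℕ
Ω (n , Irrelevant.[ nz ]) = length (factors (factorise n {{nz}}))

Ω-factorisation : ∀ n (f : PrimeFactorisation (value n)) → Ω n ≡ length (factors f)
Ω-factorisation (n , Irrelevant.[ nz ]) f = ↭-length (factorisationUnique (factorise n {{nz}}) f)

-- Write b = q * a. If q has no prime factor, then q = 1 and a = b. Otherwise c = p * a for a prime
-- factor p of q: adjoining p to a factorisation of a gives one of c, and unique factorisation fixes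
-- its length.
∣⇒∃-cover : ∀ {a b} → a ∣ b → a ≢ b → ∃ λ c → a ∣ c × c ∣ b × Ω c ≡ suc (Ω a)
∣⇒∃-cover {a@(m , Irrelevant.[ m≢0 ])} {n , Irrelevant.[ n≢0 ]} (divides q refl) a≢b
  with factorise q {{m*n≢0⇒m≢0 q {{n≢0}}}}
... | record { factors = List.[] ; isFactorisation = refl } =
  ⊥-elim (a≢b (value-injective (sym (*-identityˡ m))))
... | record { factors = p List.∷ _ ; isFactorisation = refl ; factorsPrime = p-prime All.∷ _ } =
  c , n∣m*n p , *-monoˡ-∣ m (m∣m*n {p} _) , Ω-factorisation c factorisation
  where
  c : ℕ⁺
  c = p * m , Irrelevant.[ m*n≢0 p m {{prime⇒nonZero p-prime}} {{m≢0}} ]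

  fₘ : PrimeFactorisation m
  fₘ = factorise m {{m≢0}}

  factorisation : PrimeFactorisation (p * m)
  factorisation = record
    { factors         = p List.∷ factors fₘ
    ; isFactorisation = cong (p *_) (PrimeFactorisation.isFactorisation fₘ)
    ; factorsPrime    = p-prime All.∷ PrimeFactorisation.factorsPrime fₘ
    }

Even-Ω : Subset
Even-Ω n = parity (Ω n) ≡ 0ℙ

parity-suc : ∀ n → ¬ (parity n ≡ 0ℙ ⇔ parity (suc n) ≡ 0ℙ)
parity-suc n h with parity n | parity (suc n) | suc-homo-⁻¹ n
... | 0ℙ | 1ℙ | _ with () ← to h refl
... | 1ℙ | 0ℙ | _ with () ← from h refl

-- Boolean codes of subsets, and antichains in ultrafilters

decode : (ℕ → Bool) → Subset
decode f n = f (value n) ≡ true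

module _ (em : ∀ {ℓ} → ExcludedMiddle ℓ) where

  ∈⇒Satisfiable : ∀ (F : βℕ) {A} → A ∈ sets F → Satisfiable A
  ∈⇒Satisfiable F {A} A∈F with em {P = Satisfiable A}
  ... | yes p = p
  ... | no ¬p = ⊥-elim (βℕ.∅∉ F (βℕ.⊆-closed F (λ a → ¬p (-, a)) A∈F))

  antichain∈ : ∀ {F H A} → F =~ H → A ∈ sets F → Antichain A → A ∈ sets H
  antichain∈ {F} {H} {A} (F∣H , H∣F) A∈F anti with βℕ.ultra H Multiples
    where
    Multiples : Subset
    Multiples n = ∃ λ a → a ∈ A × a ∣ n × a ≢ n
  -- `Multiples` is upward closed, so `H ∣~ F` would put it into `F`, although it is disjoint from
  -- the antichain.
  ... | inj₁ M∈H = ⊥-elim (disjoint∉ F A∈F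
          (λ (n∈A , a , a∈A , a∣n , a≢n) → anti a∈A n∈A a≢n a∣n)
          (H∣F (M∈H , ∈⇒Satisfiable H M∈H , (λ {n} n∈M → n , n∈M , ∣-refl) ,
            λ (m , (a , a∈A , a∣m , a≢m) , m∣n) →
              a , a∈A , ∣-trans a∣m m∣n ,
              -- If a = n, then a and m divide each other and are equal.
              λ { refl → a≢m (value-injective (∣-antisym a∣m m∣n)) })))
  ... | inj₂ ∁M∈H = βℕ.⊆-closed H only (βℕ.∩-closed H A↑∈H ∁M∈H)
    where
    A↑∈H : A ↑ ∈ sets H
    A↑∈H = F∣H
      ( βℕ.⊆-closed F (λ {a} a∈A → a , a∈A , ∣-refl) A∈F
      , (let a , a∈A = ∈⇒Satisfiable F A∈F in a , a , a∈A , ∣-refl)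
      , (λ {n} n∈A↑ → n , n∈A↑ , ∣-refl)
      , λ (m , (a , a∈A , a∣m) , m∣n) → a , a∈A , ∣-trans a∣m m∣n )

    only : _ ⊆ A
    only {n} ((a , a∈A , a∣n) , ¬m) with em {P = a ≡ n}
    ... | yes refl = a∈A
    ... | no  a≢n  = ⊥-elim (¬m (a , a∈A , a∣n , a≢n))

  iii⇒i : ∀ F → (∃ λ A → A ∈ sets F × Antichain A) → IsSingleton [ F ]
  iii⇒i F (A , A∈F , anti) = F , λ H → mk⇔
    (λ F=~H → let F≋H = ⊆⇒≋ F H (⊆H {H} F=~H) in proj₂ F≋H , proj₁ F≋H)
    (λ (H⊆F , F⊆H) → (F⊆H ∘ proj₁) , (H⊆F ∘ proj₁))
    where
    ⊆H : ∀ {H} → F =~ H → sets F ⊆ sets H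
    ⊆H {H} F=~H C∈F = βℕ.⊆-closed H proj₁
      -- A subset of an antichain is an antichain, so the lemma applies to the intersection of A
      -- with any C in `F`.
      (antichain∈ {F} {H} F=~H (βℕ.∩-closed F C∈F A∈F)
        λ (_ , a∈A) (_ , b∈A) → anti a∈A b∈A)

  -- Excluded middle makes membership Boolean. The code tests whether a number is the value of some
  -- member of A, which also settles 0; injectivity of `value` recovers membership.
  encode : ∀ (A : Subset) → ∃ λ f → decode f ≐ A
  encode A = f , sound , λ {a} a∈A → dec-true em (a , refl , a∈A)
    where
    f : ℕ → Bool
    f n = does (em {P = ∃ λ a → value a ≡ n × a ∈ A})

    sound : decode f ⊆ A
    sound {n} fn with em {P = ∃ λ a → value a ≡ value n × a ∈ A}
    sound refl | yes (a , a≡n , a∈A) = subst A (value-injective a≡n) a∈A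

-- Consequences of transfer

module _ (E : NonstandardExtension) where

  open NonstandardExtension E renaming (*_ to star)

  -- `⌜ U ⌝` is put in front of the parameters as the quantifier bound. It consists of all
  -- urelements, and by `*-ℕ` so does its star; hence transfer of the bounded translation gives
  -- transfer of φ.
  transferFO : ∀ {k} (φ : FOFormula k 0) (P : Vector (Superstructure ℕ⁺) k) →
               Holds φ (proj₁ ∘ P) [] → Holds φ (proj₁ ∘ star ∘ P) []
  transferFO φ P h =
    to (bounded-⇔ φ {ρ = proj₁ ∘ star ∘ (⌜ U ⌝ ∷ P)} *-ℕ
          (λ j → ≈-refl (proj₁ (star (P j)))) (λ ()))
      (to (transfer (bounded φ zero suc (λ ())) (⌜ U ⌝ ∷ P))
        (from (bounded-⇔ φ {ρ = proj₁ ∘ (⌜ U ⌝ ∷ P)}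
          ((λ (a , _) → a , refl) , (λ a → (a , tt) , refl))
          (λ j → ≈-refl (proj₁ (P j))) (λ ())) h))

  *-subset : ∀ {A B : Subset} → A ⊆ B → ∀ {x} → tp E x A → tp E x B
  *-subset {A} {B} A⊆B {x} = transferFO (all (∈₁ 0F 0F ⇒′ ∈₁ 0F 1F)) (⌜ A ⌝ ∷ ⌜ B ⌝ ∷ [])
    (λ _ → from ∈⌜⌝⇔ ∘ A⊆B ∘ to ∈⌜⌝⇔) x

  -- Transfer of `∣⇒∃-cover`. From the equation for `Ω` only the change of parity is kept, since it
  -- can be stated with the single subset `Even-Ω` as a parameter.
  *∣⇒∃-between : ∀ {x y} → _*∣_ E x y → x ≢ y →
                 ∃ λ z → _*∣_ E x z × _*∣_ E z y × ¬ (tp E x Even-Ω ⇔ tp E z Even-Ω)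
  *∣⇒∃-between {x} {y} x∣y x≢y = let z , x∣z , z∣y , differ = h x y x∣y x≢y in
    z , x∣z , z∣y , λ e → differ (to e , from e)
    where
    h = transferFO
      (all (all (∈₂ 1F 0F 1F ⇒′ (eq 1F 0F ⇒′ ⊥′) ⇒′
        ex (∈₂ 2F 0F 1F ∧′ ∈₂ 0F 1F 1F ∧′
            ((∈₁ 2F 0F ⇒′ ∈₁ 0F 0F) ∧′ (∈₁ 0F 0F ⇒′ ∈₁ 2F 0F) ⇒′ ⊥′)))))
      (⌜ Even-Ω ⌝ ∷ ⌜∣⌝ ∷ [])
      λ a b a∣b a≢b → let c , a∣c , c∣b , Ωc≡ = ∣⇒∃-cover (to ∈⌜⌝₂⇔ a∣b) a≢b in
        c , from ∈⌜⌝₂⇔ a∣c , from ∈⌜⌝₂⇔ c∣b , λ (f , g) → parity-suc (Ω a)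
          (subst (λ k → parity (Ω a) ≡ 0ℙ ⇔ parity k ≡ 0ℙ) Ωc≡
            (mk⇔ (to ∈⌜⌝⇔ ∘ f ∘ from ∈⌜⌝⇔) (to ∈⌜⌝⇔ ∘ g ∘ from ∈⌜⌝⇔)))

  -- The outer quantifier ranges over members of the relation, not over urelements as in
  -- `FOFormula`, so a bounded formula is transferred directly.
  *-pair : ∀ {R : Rel ℕ⁺ 0ℓ} {p} → p ε proj₁ (star ⌜ R ⌝₂) →
           ∃₂ λ x y → p ≈ ⟨ atom x , atom y ⟩
  *-pair {R} {p} (i , p≈) =
    let j , k , h = to (transfer φ (⌜ U ⌝ ∷ ⌜ R ⌝₂ ∷ [])) standard i
        x , x≈ = ≈-members N (set *ℕ atom) *-ℕ j
        y , y≈ = ≈-members N (set *ℕ atom) *-ℕ k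
        q = proj₁ (star ⌜ R ⌝₂) ! i
    in x , y , ≈-trans p q ⟨ atom x , atom y ⟩ p≈
         (≈-trans q ⟨ N ! j , N ! k ⟩ ⟨ atom x , atom y ⟩
           (to (isPair-⇔ (N ! k ∷ N ! j ∷ q ∷ proj₁ ∘ star ∘ (⌜ U ⌝ ∷ ⌜ R ⌝₂ ∷ [])) 2F 1F 0F) h)
           (⟨⟩-cong {x = N ! j} {atom x} {N ! k} {atom y} x≈ y≈))
    where
    N : V *ℕ
    N = proj₁ (star ⌜ U ⌝)

    φ : BoundedFormula 2
    -- Indices shift under binders: `1F` is first the relation, then `⌜ U ⌝`, which becomes `2F`
    -- under the next binder.
    φ = all∈ 1F (ex∈ 1F (ex∈ 2F (isPair 2F 1F 0F)))

    standard : ⟦ φ ⟧ (proj₁ ∘ (⌜ U ⌝ ∷ ⌜ R ⌝₂ ∷ []))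
    standard (a , b , _) = (a , tt) , (b , tt) ,
      from (isPair-⇔ (atom b ∷ atom a ∷ ⟨ atom a , atom b ⟩ ∷ proj₁ ∘ (⌜ U ⌝ ∷ ⌜ R ⌝₂ ∷ [])) 2F 1F 0F)
        (≈-refl ⟨ atom a , atom b ⟩)

  -- Transfer turns membership of a in {a} into membership of the star of a in the star of {a}.
  *-internal : ∀ a → Internal E (proj₁ (star a))
  *-internal a@(v , n , r) = ⁅a⁆ ,
    to (transfer (mem 0F 1F) (a ∷ ⁅a⁆ ∷ [])) (true , ≈-refl v)
    where
    ⁅a⁆ : Superstructure ℕ⁺
    ⁅a⁆ = ⁅ v , v ⁆ , suc n , λ { true → r ; false → r }

  *-cong : ∀ {a b} → proj₁ a ≈ proj₁ b → proj₁ (star a) ≈ proj₁ (star b)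
  *-cong {a} {b} = to (transfer (eq 0F 1F) (a ∷ b ∷ []))

  -- Types of nonstandard numbers and their divisibility

  module _ (em : ∀ {ℓ} → ExcludedMiddle ℓ) where

    typeOf : *ℕ → βℕ
    typeOf x = record
      { sets     = tp E x
      ; U∈       = ≈-members (set *ℕ atom) _ (≈-sym _ (set *ℕ atom) *-ℕ) x
      ; ∅∉       = transferFO (all (∈₁ 0F 0F ⇒′ ⊥′)) (⌜ ∅ ⌝ ∷ []) (λ _ → to ∈⌜⌝⇔) x
      ; ∩-closed = λ {A} {B} p q → transferFO
          (all (∈₁ 0F 0F ⇒′ ∈₁ 0F 1F ⇒′ ∈₁ 0F 2F)) (⌜ A ⌝ ∷ ⌜ B ⌝ ∷ ⌜ A ∩ B ⌝ ∷ [])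
          (λ _ p q → from ∈⌜⌝⇔ (to ∈⌜⌝⇔ p , to ∈⌜⌝⇔ q)) x p q
      ; ⊆-closed = λ A⊆B → *-subset A⊆B
      ; ultra    = λ A → transferFO (all (∈₁ 0F 0F ∨′ ∈₁ 0F 1F)) (⌜ A ⌝ ∷ ⌜ ∁ A ⌝ ∷ [])
          (λ n → Sum.map (from ∈⌜⌝⇔) (from ∈⌜⌝⇔) (excluded A n)) x
      }
      where
      excluded : ∀ (A : Subset) n → n ∈ A ⊎ n ∈ ∁ A
      excluded A n with em {P = n ∈ A}
      ... | yes n∈A = inj₁ n∈A
      ... | no  n∉A = inj₂ n∉A

    -- Upward closure of C under divisibility is a first-order property of C and transfers.
    *∣⇒∣~ : ∀ {x y} → _*∣_ E x y → typeOf x ∣~ typeOf y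
    *∣⇒∣~ {x} {y} x∣y {C} (x∈C , _ , _ , C↑⊆C) = transferFO
      (all (all (∈₂ 1F 0F 1F ⇒′ ∈₁ 1F 0F ⇒′ ∈₁ 0F 0F))) (⌜ C ⌝ ∷ ⌜∣⌝ ∷ [])
      (λ a b a∣b a∈C → from ∈⌜⌝⇔ (C↑⊆C (a , to ∈⌜⌝⇔ a∈C , to ∈⌜⌝₂⇔ a∣b)))
      x y x∣y x∈C

    i⇒ii : ∀ F → IsSingleton [ F ] →
           ¬ (∃₂ λ x y → Generator E F x × Generator E F y × x ≢ y × _*∣_ E x y)
    i⇒ii F (G , single) (x , y , (x⊆F , F⊆x) , (y⊆F , F⊆y) , x≢y , x∣y) =
      let z , x∣z , z∣y , differ = *∣⇒∃-between x∣y x≢y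
          F≋G   = to (single F) (proj₁ , proj₁)
          -- As x and y both generate `F`, the chain x, z, y gives `F ∣~ typeOf z` and
          -- `typeOf z ∣~ F`.
          tpz≋G = to (single (typeOf z))
            ( (λ {C} (C∈F , C∈𝒰) → *∣⇒∣~ {x} {z} x∣z {C} (F⊆x {C} C∈F , C∈𝒰))
            , (λ {C} (C∈z , C∈𝒰) → y⊆F {C} (*∣⇒∣~ {z} {y} z∣y {C} (C∈z , C∈𝒰))) )
      in differ (mk⇔ (λ p → proj₂ tpz≋G (proj₁ F≋G (x⊆F {Even-Ω} p)))
                     (λ p → F⊆x {Even-Ω} (proj₂ F≋G (proj₁ tpz≋G p))))

    ii⇒iii : 𝔠⁺-Saturated E → ∀ F →
             ¬ (∃₂ λ x y → Generator E F x × Generator E F y × x ≢ y × _*∣_ E x y) →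
             ∃ λ A → A ∈ sets F × Antichain A
    ii⇒iii saturated F noGenerators with em {P = ∃ λ A → A ∈ sets F × Antichain A}
    ... | yes p = p
    ... | no ¬antichain = ⊥-elim (noGenerators
        (x , y , generator proj₁ , generator (proj₁ ∘ proj₂) ,
         proj₁ (proj₂ (proj₂ (spec {U} U∈))) , proj₂ (proj₂ (proj₂ (spec {U} U∈)))))
      where
      open βℕ F using (U∈; ∩-closed; ⊆-closed)

      ∃-ProperDivisors : ∀ {A} → A ∈ sets F → ∃₂ (ProperDivisors A)
      ∃-ProperDivisors {A} A∈F with em {P = ∃₂ (ProperDivisors A)}
      ... | yes p = p
      ... | no ¬p = ⊥-elim (¬antichain (A , A∈F , λ a∈A b∈A a≢b a∣b →
                      ¬p (-, -, a∈A , b∈A , a≢b , a∣b)))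

      -- Saturation asks for an injection of the indices into `ℕ → Bool`, so the members of `F` are
      -- indexed by their codes. Comparing codes only, and not membership proofs, makes the
      -- projection injective.
      I : Setoid 0ℓ 0ℓ
      I = On.setoid {B = ∃ λ f → decode f ∈ sets F} (ℕ →-setoid Bool) proj₁

      open Setoid I using (Carrier) renaming (_≈_ to _≗ᴵ_)

      S : Carrier → V *ℕ
      S (f , _) = proj₁ (star ⌜ ProperDivisors (decode f) ⌝₂)

      S-cong : ∀ {i j} → i ≗ᴵ j → S i ≈ S j
      S-cong {f , _} {g , _} f≗g = *-cong {⌜ _ ⌝₂} {⌜ _ ⌝₂} (⌜ProperDivisors⌝-cong
        ((λ {n} p → trans (sym (f≗g (value n))) p) , (λ {n} p → trans (f≗g (value n)) p)))

      -- `ProperDivisors` is monotone, so the finite intersection property reduces to a single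
      -- member of `F` below all the given ones.
      ⋂ : (is : List Carrier) → ∃ λ A → A ∈ sets F × All (λ i → A ⊆ decode (proj₁ i)) is
      ⋂ List.[] = U , U∈ , All.[]
      ⋂ ((f , f∈F) List.∷ is) = let A , A∈F , A⊆ = ⋂ is in
        decode f ∩ A , ∩-closed f∈F A∈F , proj₁ All.∷ All.map (λ A⊆i {n} n∈ → A⊆i (proj₂ n∈)) A⊆

      finite : ∀ is → ∃ λ x → All (λ i → x ε S i) is
      finite is =
        let A , A∈F , A⊆ = ⋂ is
            a , b , a∈A , b∈A , r = ∃-ProperDivisors A∈F
            ⟨a,b⟩ = ⟨ atom a , atom b ⟩ , 2 ,
              λ { true → λ { true → tt ; false → tt } ; false → λ { true → tt ; false → tt } }
        -- The star of a standard pair works: transfer carries its memberships over to each `S i`.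
        in proj₁ (star ⟨a,b⟩) , All.map (λ {i} A⊆i →
             to (transfer (mem 0F 1F) (⟨a,b⟩ ∷ ⌜ ProperDivisors (decode (proj₁ i)) ⌝₂ ∷ []))
               (from ∈⌜⌝₂⇔ (A⊆i a∈A , A⊆i b∈A , r))) A⊆

      common : ∃ λ p → ∀ i → p ε S i
      common = saturated I (record { to = proj₁ ; cong = id ; injective = id })
                 S (λ {i} {j} → S-cong {i} {j}) (λ _ → *-internal _) finite

      index : ∀ {A} → A ∈ sets F → Carrier
      index {A} A∈F = let f , _ , A⊆ = encode em A in f , ⊆-closed A⊆ A∈F

      xy : ∃₂ λ x y → proj₁ common ≈ ⟨ atom x , atom y ⟩
      xy = *-pair {_} {proj₁ common} (proj₂ common (index U∈))

      x y : *ℕ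
      x = proj₁ xy
      y = proj₁ (proj₂ xy)

      -- The common member lies in the star of `ProperDivisors` at the code of A, and the four
      -- clauses of that definition transfer.
      spec : ∀ {A} → A ∈ sets F → tp E x A × tp E y A × x ≢ y × _*∣_ E x y
      spec {A} A∈F = transferFO
        (all (all (∈₂ 1F 0F 0F ⇒′ ∈₁ 1F 1F ∧′ ∈₁ 0F 1F ∧′ (eq 1F 0F ⇒′ ⊥′) ∧′ ∈₂ 1F 0F 2F)))
        (⌜ ProperDivisors (decode (proj₁ (index A∈F))) ⌝₂ ∷ ⌜ A ⌝ ∷ ⌜∣⌝ ∷ [])
        (λ a b r → let a∈ , b∈ , a≢b , a∣b = to ∈⌜⌝₂⇔ r; decode⊆A = proj₁ (proj₂ (encode em A)) in
          from ∈⌜⌝⇔ (decode⊆A a∈) , from ∈⌜⌝⇔ (decode⊆A b∈) , a≢b , from ∈⌜⌝₂⇔ a∣b)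
        x y
        (ε-resp {x = proj₁ common} {⟨ atom x , atom y ⟩} {S (index A∈F)} {S (index A∈F)}
          (proj₂ (proj₂ xy)) (≈-refl (S (index A∈F))) (proj₂ common (index A∈F)))

      -- By maximality one inclusion suffices. The argument `h` selects a coordinate, so that x and
      -- y are handled together.
      generator : ∀ {z} → (∀ {A} → tp E x A × tp E y A × x ≢ y × _*∣_ E x y → tp E z A) →
                  Generator E F z
      generator {z} h = let F⊆z , z⊆F = ⊆⇒≋ F (typeOf z) (h ∘ spec) in z⊆F , F⊆z

theorem5p1 : (∀ {ℓ} → ExcludedMiddle ℓ) →
    (E : NonstandardExtension) → 𝔠⁺-Saturated E → IsomorphismProperty E →
    (F : βℕ) →
    let
    i   = IsSingleton [ F ]
    ii  = ¬ (∃₂ λ x y → Generator E F x × Generator E F y × x ≢ y × _*∣_ E x y)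
    iii = ∃ λ A → A ∈ sets F × Antichain A
    in
    (i ⇔ ii) × (ii ⇔ iii)
theorem5p1 em E saturated _ F =
  mk⇔ (i⇒ii E em F) (iii⇒i em F ∘ ii⇒iii E em saturated F) ,
  mk⇔ (ii⇒iii E em saturated F) (i⇒ii E em F ∘ iii⇒i em F)
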